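{- $t(4)=7$.
   Context: Let $\mathfrak{C}=\{0,1\}^n$ be the vertex set of the $n$-dimensional hypercube; $\oplus,\wedge$ denote bitwise XOR and AND. An outmap is any function $s:\mathfrak{C}\to\{0,1\}^n$. A clash of $s$ is a pair of distinct vertices $u,v$ with $(s(u)\oplus s(v))\wedge(u\oplus v)=0^n$. A query at $u$ to the oracle for $s$ returns $s(u)$; algorithms choose queries adaptively, and only the number of queries is counted. \textsc{Sink-or-Clash}: given oracle access to an arbitrary outmap $s$, query either a vertex $u$ with $s(u)=0^n$ or both vertices of some clash. $t(n)=\min_{\mathcal A}\max_s t(\mathcal A,s)$, where $\mathcal A$ ranges over deterministic algorithms solving \textsc{Sink-or-Clash} on all outmaps of the $n$-cube and $t(\mathcal A,s)$ is the number of queries made on $s$. -}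

module Defs where

open import Data.Bool.Base using (Bool; false; _∧_; _xor_)
open import Data.List.Base using (List; []; _∷_; length)
open import Data.List.Membership.Propositional using (_∈_)
open import Data.Nat.Base using (ℕ; _≤_)
open import Data.Product.Base using (_×_; ∃-syntax)
open import Data.Sum.Base using (_⊎_)
open import Data.Vec.Base using (Vec; replicate; zipWith)
open import Relation.Binary.PropositionalEquality using (_≡_; _≢_)

private
  variable
    n : ℕ

Bits : ℕ → Set
Bits = Vec Bool

𝟎 : Bits n
𝟎 = replicate _ false

infixl 6 _⊕_
infixl 7 _&_

_⊕_ : Bits n → Bits n → Bits n
_⊕_ = zipWith _xor_

_&_ : Bits n → Bits n → Bits n
_&_ = zipWith _∧_

Outmap : ℕ → Set
Outmap n = Bits n → Bits n

IsSink : Outmap n → Bits n → Set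
IsSink s u = s u ≡ 𝟎

IsClash : Outmap n → Bits n → Bits n → Set
IsClash s u v = u ≢ v × (s u ⊕ s v) & (u ⊕ v) ≡ 𝟎

-- A deterministic adaptive algorithm is a decision tree: the next step may
-- depend on all answers so far.  Trees are well-founded, so every run halts.
-- Repeated queries are allowed, and each one is counted.
data Algorithm (n : ℕ) : Set where
  stop  : Algorithm n
  query : (u : Bits n) → (answer→next : Bits n → Algorithm n) → Algorithm n

queried : Algorithm n → Outmap n → List (Bits n)
queried stop        s = []
queried (query u k) s = u ∷ queried (k (s u)) s

#queries : Algorithm n → Outmap n → ℕ
#queries A s = length (queried A s)

SolvesSinkOrClash : Algorithm n → Set
SolvesSinkOrClash {n} A = (s : Outmap n) →
  (∃[ u ] u ∈ queried A s × IsSink s u)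
  ⊎ (∃[ u ] ∃[ v ] u ∈ queried A s × v ∈ queried A s × IsClash s u v)

IsMin : (ℕ → Set) → ℕ → Set
IsMin P m = P m × (∀ k → P k → m ≤ k)

IsMax : (ℕ → Set) → ℕ → Set
IsMax P m = P m × (∀ k → P k → k ≤ m)

-- m = max_s t(A, s)
WorstCase : Algorithm n → ℕ → Set
WorstCase {n} A = IsMax λ k → ∃[ s ] #queries A s ≡ k

-- t[ n ]≡ m says t(n) = m.  It is a relation because the minimum ranges over
-- the infinite type of algorithms; by antisymmetry of ≤ at most one m satisfies it.
t[_]≡_ : ℕ → ℕ → Set
t[ n ]≡ m = IsMin (λ k → ∃[ A ] SolvesSinkOrClash {n} A × WorstCase A k) m

{-# OPTIONS --safe #-}
module Submission where

-- Upper bound: query the four vertices 0000, 1111, 0011, 1100 whatever the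
-- answers are, then three more vertices, each chosen among those where the
-- answer 0000 would not clash with anything seen so far (if there are any).
--
-- Lower bound: after a translation the first query is 0000; answer 1111.  If
-- the second query lies in a facet xᵢ = 0, the adversary gives away the answers
-- v ↦ ¬ v on this whole facet.  They all have i-th bit 1, so the opposite facet
-- with i-th bits 0 is a fresh 3-cube, where four more queries are not enough.
-- If the second query is 1111, finding answers is left to the search.
--
-- Both claims are thereby finite searches, which are decided by evaluation.

open import Defs

open import Data.Bool.Base using (Bool; true; false; T; not; _∧_; _∨_; _xor_)
open import Data.Bool.ListAction using (any; all)
open import Data.Bool.Properties
  using (_≟_; T?; T-∧; T-∨; T-≡; T-not-≡; xor-comm; xor-assoc; xor-same; xor-identityʳ)
open import Data.Fin.Base using (Fin)
open import Data.List.Base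
  using (List; []; _∷_; _++_; allFin; filterᵇ; length; map; reverse)
open import Data.List.Membership.DecPropositional using (_∈?_)
open import Data.List.Membership.Propositional using (_∈_; _∉_; find)
open import Data.List.Membership.Propositional.Properties
  using (∈-++⁺ˡ; ∈-++⁺ʳ; ∈-++⁻; ∈-filter⁺; ∈-filter⁻; ∈-map⁺)
open import Data.List.Properties using (length-map; ++-identityʳ)
open import Data.List.Relation.Binary.Permutation.Propositional using (↭-sym)
open import Data.List.Relation.Binary.Permutation.Propositional.Properties using (shift)
open import Data.List.Relation.Binary.Subset.Propositional using (_⊆_)
open import Data.List.Relation.Binary.Subset.Propositional.Properties
  using (⊆-reflexive-↭)
open import Data.List.Relation.Unary.All as All using (All; []; _∷_)
import Data.List.Relation.Unary.All.Properties as All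
open import Data.List.Relation.Unary.Any using (here; there)
open import Data.List.Relation.Unary.Any.Properties using (any⁻; reverse⁺)
open import Data.Nat.Base using (ℕ; zero; suc; _+_; _≤_; s≤s⁻¹)
open import Data.Nat.Properties using (≤-refl; ≤-reflexive; ≤-trans; n≤1+n; ≮⇒≥)
open import Data.Product.Base using (_×_; _,_; ∃-syntax; proj₁; proj₂)
open import Data.Sum.Base using (_⊎_; inj₁; inj₂)
open import Data.Unit.Base using (tt)
open import Data.Vec.Base as Vec using ([]; _∷_)
open import Data.Vec.Properties
  using (≡-dec; zipWith-assoc; zipWith-comm; zipWith-identityʳ)
open import Function.Base using (_∘_; const)
open import Function.Bundles using (Equivalence)
open import Relation.Binary.Definitions using (DecidableEquality)
open import Relation.Binary.PropositionalEquality
open import Relation.Nullary.Decidable.Core using (yes; no)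
open import Relation.Nullary.Negation.Core using (¬_; contradiction)

open Equivalence using (to; from)

private
  variable
    n : ℕ
    s s′ : Outmap n
    u v w a b c : Bits n
    Q R L : List (Bits n)

-- Bit vectors and Boolean tests on them.

_≟ᵇ_ : DecidableEquality (Bits n)
_≟ᵇ_ = ≡-dec _≟_

⊕-comm : (u v : Bits n) → u ⊕ v ≡ v ⊕ u
⊕-comm = zipWith-comm xor-comm

⊕-self : (u : Bits n) → u ⊕ u ≡ 𝟎
⊕-self []      = refl
⊕-self (x ∷ u) = cong₂ _∷_ (xor-same x) (⊕-self u)

⊕-cancelʳ : (u c : Bits n) → u ⊕ c ⊕ c ≡ u
⊕-cancelʳ u c = begin
  u ⊕ c ⊕ c    ≡⟨ zipWith-assoc xor-assoc u c c ⟩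
  u ⊕ (c ⊕ c)  ≡⟨ cong (u ⊕_) (⊕-self c) ⟩
  u ⊕ 𝟎        ≡⟨ zipWith-identityʳ xor-identityʳ u ⟩
  u            ∎
  where open ≡-Reasoning

⊕-translate : (u v c : Bits n) → (u ⊕ c) ⊕ (v ⊕ c) ≡ u ⊕ v
⊕-translate u v c = begin
  (u ⊕ c) ⊕ (v ⊕ c)  ≡⟨ cong (u ⊕ c ⊕_) (⊕-comm v c) ⟩
  (u ⊕ c) ⊕ (c ⊕ v)  ≡⟨ zipWith-assoc xor-assoc (u ⊕ c) c v ⟨
  u ⊕ c ⊕ c ⊕ v      ≡⟨ cong (_⊕ v) (⊕-cancelʳ u c) ⟩
  u ⊕ v              ∎
  where open ≡-Reasoning

distinct : Bits n → Bits n → Bool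
distinct []      []      = false
distinct (x ∷ u) (y ∷ v) = (x xor y) ∨ distinct u v

distinct⇒≢ : (u : Bits n) → T (distinct u v) → u ≢ v
distinct⇒≢ (x ∷ u) d refl rewrite xor-same x = distinct⇒≢ u d refl

¬distinct⇒≡ : (u v : Bits n) → ¬ T (distinct u v) → u ≡ v
¬distinct⇒≡ []          []          ¬d = refl
¬distinct⇒≡ (true ∷ u)  (true ∷ v)  ¬d = cong (true ∷_) (¬distinct⇒≡ u v ¬d)
¬distinct⇒≡ (true ∷ u)  (false ∷ v) ¬d = contradiction tt ¬d
¬distinct⇒≡ (false ∷ u) (true ∷ v)  ¬d = contradiction tt ¬d
¬distinct⇒≡ (false ∷ u) (false ∷ v) ¬d = cong (false ∷_) (¬distinct⇒≡ u v ¬d)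

same : Bits n → Bits n → Bool
same u v = not (distinct u v)

same⇒≡ : (u v : Bits n) → T (same u v) → u ≡ v
same⇒≡ u v e = ¬distinct⇒≡ u v λ d → subst T (to T-not-≡ e) d

-- A one-pass, short-circuiting test that the clash equation fails, in the form that the searches
-- evaluate.
separated : (u v a b : Bits n) → Bool
separated []      []      []      []      = false
separated (x ∷ u) (y ∷ v) (p ∷ a) (q ∷ b) =
  ((p xor q) ∧ (x xor y)) ∨ separated u v a b

separated-correct : (u v a b : Bits n) →
                    separated u v a b ≡ distinct ((a ⊕ b) & (u ⊕ v)) 𝟎
separated-correct []      []      []      []      = refl
separated-correct (x ∷ u) (y ∷ v) (p ∷ a) (q ∷ b) =
  cong₂ _∨_ (sym (xor-identityʳ _)) (separated-correct u v a b)

separated⇒≢𝟎 : ∀ u v a b → T (separated {n} u v a b) → (a ⊕ b) & (u ⊕ v) ≢ 𝟎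
separated⇒≢𝟎 u v a b p = distinct⇒≢ _ (subst T (separated-correct u v a b) p)

¬separated⇒≡𝟎 : ∀ u v a b → ¬ T (separated {n} u v a b) → (a ⊕ b) & (u ⊕ v) ≡ 𝟎
¬separated⇒≡𝟎 u v a b ¬p =
  ¬distinct⇒≡ _ _ (¬p ∘ subst T (sym (separated-correct u v a b)))

-- Vertices, outcomes and positions of the game.

cube : ∀ n → List (Bits n)
cube zero    = [] ∷ []
cube (suc n) = map (false ∷_) (cube n) ++ map (true ∷_) (cube n)

∈-cube : (u : Bits n) → u ∈ cube n
∈-cube []          = here refl
∈-cube (false ∷ u) = ∈-++⁺ˡ (∈-map⁺ _ (∈-cube u))
∈-cube (true ∷ u)  = ∈-++⁺ʳ _ (∈-map⁺ _ (∈-cube u))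

-- The goal of `SolvesSinkOrClash` for any list of vertices, so that it can also be stated in
-- mid-run.
Caught : Outmap n → List (Bits n) → Set
Caught s Q = (∃[ u ] u ∈ Q × IsSink s u)
           ⊎ (∃[ u ] ∃[ v ] u ∈ Q × v ∈ Q × IsClash s u v)

Caught-mono : Q ⊆ R → Caught s Q → Caught s R
Caught-mono Q⊆R (inj₁ (u , u∈Q , sink))            = inj₁ (u , Q⊆R u∈Q , sink)
Caught-mono Q⊆R (inj₂ (u , v , u∈Q , v∈Q , clash)) = inj₂ (u , v , Q⊆R u∈Q , Q⊆R v∈Q , clash)

¬Caught-[] : ¬ Caught s []
¬Caught-[] (inj₁ (_ , () , _))
¬Caught-[] (inj₂ (_ , _ , () , _))

-- Unqueried vertices, each with answers that clash with no earlier one.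
-- The algorithm needs all such answers to be listed, the adversary may do
-- with fewer; hence the two invariants Covers and Fair below.
Table : ℕ → Set
Table n = List (Bits n × List (Bits n))

refine : Bits n → Bits n → Table n → Table n
refine u a = map (λ (w , L) → w , filterᵇ (separated u w a) L) ∘ filterᵇ (distinct u ∘ proj₁)

-- Upper bound

-- Prunes the search for the last three queries; 𝟎 comes first in every
-- answer list that contains it.
promising : ℕ → List (Bits n) → Bool
promising (suc (suc (suc _))) _       = true
promising _                   []      = true
promising _                   (a ∷ _) = same a 𝟎

-- Once `L` is empty, every answer at `u` clashes with an earlier one, so querying `u` wins at once.
wins : ℕ → Table n → Bool
wins zero    Γ = false
wins (suc r) Γ =
  any (λ (u , L) → promising r L ∧ all (λ a → same a 𝟎 ∨ wins r (refine u a Γ)) L) Γ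

Covers : Outmap n → List (Bits n) → Bits n × List (Bits n) → Set
Covers s Q (w , L) = s w ∈ L ⊎ (∃[ v ] v ∈ Q × IsClash s v w)

-- The true answer at `w` is filtered out only if it clashes with the one at `u`, which is the other
-- alternative of `Covers`.
refine-covers : ∀ {Γ} → All (Covers s Q) Γ → All (Covers s (u ∷ Q)) (refine u (s u) Γ)
refine-covers {s = s} {Q} {u} {Γ} covered =
  All.map⁺ (All.zipWith step (All.all-filter (T? ∘ distinct u ∘ proj₁) Γ ,
                              All.filter⁺ (T? ∘ distinct u ∘ proj₁) covered))
  where
  step : ∀ {e} → T (distinct u (proj₁ e)) × Covers s Q e →
         Covers s (u ∷ Q) (proj₁ e , filterᵇ (separated u (proj₁ e) (s u)) (proj₂ e))
  step (_ , inj₂ (v , v∈Q , clash)) = inj₂ (v , there v∈Q , clash)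
  step {w , L} (d , inj₁ sw∈L) with T? (separated u w (s u) (s w))
  ... | yes p = inj₁ (∈-filter⁺ (T? ∘ separated u w (s u)) sw∈L p)
  ... | no ¬p = inj₂ (u , here refl , distinct⇒≢ u d , ¬separated⇒≡𝟎 u w _ _ ¬p)

-- Padding after an early win: all runs get the same length, which is then the worst case.
idle : ℕ → Algorithm n
idle zero    = stop
idle (suc r) = query 𝟎 (const (idle r))

#queries-idle : ∀ r (s : Outmap n) → #queries (idle r) s ≡ r
#queries-idle zero    s = refl
#queries-idle (suc r) s = cong suc (#queries-idle r s)

wins-sound : ∀ r (Γ : Table n) → T (wins r Γ) →
  ∃[ A ] (∀ s → #queries A s ≡ r)
       × (∀ s Q → All (Covers s Q) Γ → Caught s (Q ++ queried A s))
wins-sound {n} (suc r) Γ win with find (any⁻ _ Γ win)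
... | (u , L) , uL∈Γ , p =
  query u (proj₁ ∘ next) , (λ s → cong suc (proj₁ (proj₂ (next (s u))) s)) , catches
  where
  next : ∀ a → ∃[ B ] (∀ s → #queries B s ≡ r)
       × (a ∈ L → a ≢ 𝟎 → ∀ s Q → All (Covers s Q) (refine u a Γ) → Caught s (Q ++ queried B s))
  next a with _∈?_ _≟ᵇ_ a L
  -- An answer outside `L` has completed a clash, and the answer `𝟎` is a sink; only padding
  -- remains.
  ... | no a∉L = idle r , #queries-idle r , λ a∈L → contradiction a∈L a∉L
  ... | yes a∈L with to T-∨ (All.lookup (All.all⁺ _ L (proj₂ (to (T-∧ {promising r L}) p))) a∈L)
  ...   | inj₁ z = idle r , #queries-idle r , λ _ a≢𝟎 → contradiction (same⇒≡ a 𝟎 z) a≢𝟎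
  ...   | inj₂ win′ = let B , count , catch = wins-sound r (refine u a Γ) win′
                      in B , count , λ _ _ → catch

  catches : ∀ s Q → All (Covers s Q) Γ →
            Caught s (Q ++ u ∷ queried (proj₁ (next (s u))) s)
  catches s Q covered with All.lookup covered uL∈Γ
  ... | inj₂ (v , v∈Q , clash) = inj₂ (v , u , ∈-++⁺ˡ v∈Q , ∈-++⁺ʳ Q (here refl) , clash)
  ... | inj₁ su∈L with s u ≟ᵇ 𝟎
  ...   | yes sink = inj₁ (u , ∈-++⁺ʳ Q (here refl) , sink)
  ...   | no su≢𝟎 = Caught-mono (⊆-reflexive-↭ (↭-sym (shift u Q _)))
          (proj₂ (proj₂ (next (s u))) su∈L su≢𝟎 s (u ∷ Q) (refine-covers covered))

-- Lower bound

-- Answers given away for free; a queried vertex then costs the algorithm a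
-- query without any choice left to the adversary.
Commitment : ℕ → Set
Commitment n = List (Bits n × Bits n)

-- Each answer is tested in the table refined by the previous ones, so the answers of a legal `C` do
-- not clash among themselves either.
legal : Commitment n → Table n → Bool
legal []            Γ = true
legal ((u , a) ∷ C) Γ = any (λ (w , L) → same u w ∧ any (same a) L) Γ ∧ legal C (refine u a Γ)

play : Commitment n → Table n → Table n
play []            Γ = Γ
play ((u , a) ∷ C) Γ = play C (refine u a Γ)

module _ (commitments : ℕ → List (Commitment n)) where

  -- The filtered list is passed to a separate function so that its entries
  -- are evaluated once and not once per vertex.
  evades   : ℕ → Table n → Bool
  responds : ℕ → Table n → List (Commitment n) → Bool

  evades zero    Γ = true
  evades (suc r) Γ =
    responds r Γ (filterᵇ (λ C → legal C Γ ∧ evades r (play C Γ)) (commitments r))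

  responds r Γ Cs =
    all (λ (u , L) → any (any (same u ∘ proj₁)) Cs ∨ any (λ a → evades r (refine u a Γ)) L) Γ

-- The adversary's outmap and its invariant.

_[_↦_] : Outmap n → Bits n → Bits n → Outmap n
(s [ u ↦ a ]) v with u ≟ᵇ v
... | yes _ = a
... | no  _ = s v

[↦]-updates : ∀ (s : Outmap n) u a → (s [ u ↦ a ]) u ≡ a
[↦]-updates s u a with u ≟ᵇ u
... | yes _   = refl
... | no  u≢u = contradiction refl u≢u

[↦]-minimal : ∀ (s : Outmap n) a → u ≢ v → (s [ u ↦ a ]) v ≡ s v
[↦]-minimal {u = u} {v} s a u≢v with u ≟ᵇ v
... | yes u≡v = contradiction u≡v u≢v
... | no  _   = refl

AgreeOn : List (Bits n) → Outmap n → Outmap n → Set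
AgreeOn Q s s′ = ∀ {v} → v ∈ Q → s′ v ≡ s v

Apart : Outmap n → Bits n → Bits n → Bits n → Set
Apart s u a v = (s v ⊕ a) & (v ⊕ u) ≢ 𝟎

Open : Outmap n → List (Bits n) → Bits n × List (Bits n) → Set
Open s Q (u , L) = u ∉ Q × All (λ a → a ≢ 𝟎 × All (Apart s u a) Q) L

-- The adversary holds a total outmap, but only its values on `Q` are final. By `exhaustive`, a
-- query off the table repeats a vertex of `Q`.
record Fair (s : Outmap n) (Q : List (Bits n)) (Γ : Table n) : Set where
  field
    uncaught   : ¬ Caught s Q
    admissible : All (Open s Q) Γ
    exhaustive : ∀ w → w ∈ Q ⊎ (∃[ L ] (w , L) ∈ Γ)

open Fair

module _ {Γ : Table n} (fair : Fair s Q Γ) (uL∈Γ : (u , L) ∈ Γ) (a∈L : a ∈ L) where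
  private
    t : Outmap _
    t = s [ u ↦ a ]

    u∉Q : u ∉ Q
    u∉Q = proj₁ (All.lookup (admissible fair) uL∈Γ)

    a≢𝟎 : a ≢ 𝟎
    a≢𝟎 = proj₁ (All.lookup (proj₂ (All.lookup (admissible fair) uL∈Γ)) a∈L)

    apart : v ∈ Q → Apart s u a v
    apart = All.lookup (proj₂ (All.lookup (proj₂ (All.lookup (admissible fair) uL∈Γ)) a∈L))

    tu≡a : t u ≡ a
    tu≡a = [↦]-updates s u a

  answer-agrees : AgreeOn Q s t
  answer-agrees v∈Q = [↦]-minimal {u = u} s a λ { refl → u∉Q v∈Q }

  private
    no-clash : v ∈ Q → (t v ⊕ t u) & (v ⊕ u) ≢ 𝟎
    no-clash {v} v∈Q rewrite tu≡a | answer-agrees v∈Q = apart v∈Q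

    uncaught′ : ¬ Caught t (u ∷ Q)
    uncaught′ (inj₁ (_ , here refl , sink)) = a≢𝟎 (trans (sym tu≡a) sink)
    uncaught′ (inj₁ (v , there v∈Q , sink)) =
      uncaught fair (inj₁ (v , v∈Q , trans (sym (answer-agrees v∈Q)) sink))
    uncaught′ (inj₂ (_ , _ , here refl , here refl , u≢u , _)) = u≢u refl
    uncaught′ (inj₂ (_ , v , here refl , there v∈Q , _ , e)) =
      no-clash v∈Q (trans (cong₂ _&_ (⊕-comm (t v) (t u)) (⊕-comm v u)) e)
    uncaught′ (inj₂ (v , _ , there v∈Q , here refl , _ , e)) = no-clash v∈Q e
    uncaught′ (inj₂ (v , w , there v∈Q , there w∈Q , v≢w , e)) =
      uncaught fair (inj₂ (v , w , v∈Q , w∈Q , v≢w ,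
        subst₂ (λ x y → (x ⊕ y) & (v ⊕ w) ≡ 𝟎) (answer-agrees v∈Q) (answer-agrees w∈Q) e))

    refined : ∀ {e} → T (distinct u (proj₁ e)) × Open s Q e →
              Open t (u ∷ Q) (proj₁ e , filterᵇ (separated u (proj₁ e) a) (proj₂ e))
    refined {w , M} (d , w∉Q , good) =
      (λ { (here w≡u) → distinct⇒≢ u d (sym w≡u) ; (there w∈Q) → w∉Q w∈Q }) ,
      All.zipWith
        (λ { {b} (sep , b≢𝟎 , apartᵇ) →
             b≢𝟎 ,
             subst (λ x → (x ⊕ b) & (u ⊕ w) ≢ 𝟎) (sym tu≡a) (separated⇒≢𝟎 u w a b sep) ∷
             All.tabulate λ {v} v∈Q →
               subst (λ x → (x ⊕ b) & (v ⊕ w) ≢ 𝟎) (sym (answer-agrees v∈Q)) (All.lookup apartᵇ v∈Q) })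
        (All.all-filter (T? ∘ separated u w a) M , All.filter⁺ (T? ∘ separated u w a) good)

    exhaustive′ : ∀ w → w ∈ u ∷ Q ⊎ (∃[ M ] (w , M) ∈ refine u a Γ)
    exhaustive′ w with exhaustive fair w
    ... | inj₁ w∈Q = inj₁ (there w∈Q)
    ... | inj₂ (M , wM∈Γ) with T? (distinct u w)
    ...   | yes d = inj₂ (_ , ∈-map⁺ _ (∈-filter⁺ (T? ∘ distinct u ∘ proj₁) wM∈Γ d))
    ...   | no ¬d = inj₁ (here (sym (¬distinct⇒≡ u w ¬d)))

  answer-fair : Fair t (u ∷ Q) (refine u a Γ)
  answer-fair .uncaught   = uncaught′
  answer-fair .admissible =
    All.map⁺ (All.zipWith refined (All.all-filter (T? ∘ distinct u ∘ proj₁) Γ ,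
                                   All.filter⁺ (T? ∘ distinct u ∘ proj₁) (admissible fair)))
  answer-fair .exhaustive = exhaustive′

play-fair : ∀ {Γ : Table n} C → T (legal C Γ) → Fair s Q Γ →
  ∃[ s′ ] ∃[ R ] Fair s′ R (play C Γ) × AgreeOn Q s s′ × Q ⊆ R × map proj₁ C ⊆ R
play-fair []            _  fair = _ , _ , fair , (λ _ → refl) , (λ v∈Q → v∈Q) , λ ()
play-fair {Γ = Γ} ((u , a) ∷ C) ok fair
  with l , ok′ ← to T-∧ ok
  with (w , L) , wL∈Γ , m ← find (any⁻ _ Γ l)
  with u≡w , m′ ← to (T-∧ {same u w}) m
  with b , b∈L , a≡b ← find (any⁻ _ L m′)
  with refl ← same⇒≡ u w u≡w | refl ← same⇒≡ a b a≡b
  with s′ , R , fair′ , agree , ⊆R , C⊆R ← play-fair C ok′ (answer-fair fair wL∈Γ b∈L)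
  = s′ , R , fair′
  , (λ v∈Q → trans (agree (there v∈Q)) (answer-agrees fair wL∈Γ b∈L v∈Q))
  , ⊆R ∘ there
  , λ { (here refl) → ⊆R (here refl) ; (there v∈C) → C⊆R v∈C }

module _ (commitments : ℕ → List (Commitment n)) where

  -- A vertex asked before or given away leaves the position as it is. The budget then stays at
  -- `suc r`, as `evades` is not shown to pass to smaller budgets.
  evades-response : ∀ r {Γ} u → T (evades commitments (suc r) Γ) → Fair s Q Γ →
    ∃[ r′ ] ∃[ s′ ] ∃[ R ] ∃[ Δ ] r ≤ r′ × T (evades commitments r′ Δ) × Fair s′ R Δ
                                × AgreeOn Q s s′ × Q ⊆ R × u ∈ R
  evades-response {Q = Q} r {Γ} u ev fair with exhaustive fair u
  ... | inj₁ u∈Q =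
    suc r , _ , Q , Γ , n≤1+n r , ev , fair , (λ _ → refl) , (λ v∈Q → v∈Q) , u∈Q
  ... | inj₂ (L , uL∈Γ)
    with to (T-∨ {any (any (same u ∘ proj₁)) (filterᵇ _ (commitments r))})
            (All.lookup (All.all⁺ _ Γ ev) uL∈Γ)
  ...   | inj₁ m
    with C , C∈ , m′ ← find (any⁻ _ (filterᵇ _ (commitments r)) m)
    with _ , ok ← ∈-filter⁻ (λ C → T? (legal C Γ ∧ evades commitments r (play C Γ)))
                             {xs = commitments r} C∈
    with legalC , ev′ ← to (T-∧ {legal C Γ}) ok
    with (w , _) , wa∈C , u≡w ← find (any⁻ _ C m′)
    with refl ← same⇒≡ u w u≡w
    with s′ , R , fair′ , agree , Q⊆R , C⊆R ← play-fair C legalC fair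
    = r , s′ , R , play C Γ , ≤-refl , ev′ , fair′ , agree , Q⊆R , C⊆R (∈-map⁺ proj₁ wa∈C)
  ...   | inj₂ m
    with a , a∈L , ev′ ← find (any⁻ _ L m)
    = r , _ , _ , _ , ≤-refl , ev′ , answer-fair fair uL∈Γ a∈L
    , answer-agrees fair uL∈Γ a∈L , there , here refl

  -- Induction on the tree `A`, because the budget need not drop. The length bound speaks of outmaps
  -- agreeing on `Q`, since these are the ones whose runs reach this subtree.
  evades-sound : ∀ A r {Γ} → T (evades commitments r Γ) → Fair s Q Γ →
    (∀ s′ → AgreeOn Q s s′ → #queries A s′ ≤ r) →
    ∃[ s′ ] AgreeOn Q s s′ × ¬ Caught s′ (Q ++ queried A s′)
  evades-sound {s} {Q} stop r ev fair bound =
    s , (λ _ → refl) , uncaught fair ∘ subst (Caught s) (++-identityʳ Q)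
  evades-sound (query u k) zero ev fair bound = contradiction (bound _ (λ _ → refl)) λ ()
  evades-sound {s} {Q} (query u k) (suc r) ev fair bound
    with r′ , s₁ , R , _ , r≤r′ , ev′ , fair′ , agree , Q⊆R , u∈R ← evades-response r u ev fair
    -- As `u ∈ R`, later revisions keep the answer `s₁ u`, so the final run does enter this subtree.
    with s′ , agree′ , ¬caught ← evades-sound (k (s₁ u)) r′ ev′ fair′ (λ s′ agree′ →
           ≤-trans (s≤s⁻¹ (subst (λ a → suc (#queries (k a) s′) ≤ suc r) (agree′ u∈R)
                     (bound s′ λ v∈Q → trans (agree′ (Q⊆R v∈Q)) (agree v∈Q))))
                   r≤r′)
    = s′ , (λ v∈Q → trans (agree′ (Q⊆R v∈Q)) (agree v∈Q))
    , ¬caught ∘ Caught-mono (subst (λ a → Q ++ u ∷ queried (k (s′ u)) s′ ⊆ R ++ queried (k a) s′)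
                              (agree′ u∈R) (include (queried (k (s′ u)) s′)))
    where
    include : ∀ X → Q ++ u ∷ X ⊆ R ++ X
    include X x∈ with ∈-++⁻ Q x∈
    ... | inj₁ x∈Q         = ∈-++⁺ˡ (Q⊆R x∈Q)
    ... | inj₂ (here refl) = ∈-++⁺ˡ u∈R
    ... | inj₂ (there x∈X) = ∈-++⁺ʳ R x∈X

-- Translations of the cube and the opening query.

translate : Bits n → Algorithm n → Algorithm n
translate c stop        = stop
translate c (query u k) = query (u ⊕ c) (translate c ∘ k)

queried-translate : ∀ A (s : Outmap n) →
  queried (translate c A) s ≡ map (_⊕ c) (queried A (s ∘ (_⊕ c)))
queried-translate         stop        s = refl
queried-translate {c = c} (query u k) s =
  cong (u ⊕ c ∷_) (queried-translate (k (s (u ⊕ c))) s)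

#queries-translate : ∀ A (s : Outmap n) →
  #queries (translate c A) s ≡ #queries A (s ∘ (_⊕ c))
#queries-translate {c = c} A s =
  trans (cong length (queried-translate A s)) (length-map (_⊕ c) (queried A (s ∘ (_⊕ c))))

-- Translation changes neither the answers nor the XOR of two vertices.
Caught-translate : Caught (s ∘ (_⊕ c)) Q → Caught s (map (_⊕ c) Q)
Caught-translate {c = c} (inj₁ (u , u∈Q , sink)) = inj₁ (u ⊕ c , ∈-map⁺ _ u∈Q , sink)
Caught-translate {s = s} {c = c} (inj₂ (u , v , u∈Q , v∈Q , u≢v , e)) =
  inj₂ (u ⊕ c , v ⊕ c , ∈-map⁺ _ u∈Q , ∈-map⁺ _ v∈Q
       , (λ eq → u≢v (trans (sym (⊕-cancelʳ u c)) (trans (cong (_⊕ c) eq) (⊕-cancelʳ v c))))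
       , trans (cong ((s (u ⊕ c) ⊕ s (v ⊕ c)) &_) (⊕-translate u v c)) e)

-- Answers with many 1s come first: this keeps the adversary's search short.
untouched : ∀ n → Table n
untouched n = map (λ w → w , filterᵇ (λ a → distinct a 𝟎) (reverse (cube n))) (cube n)

-- The sinks of `const 𝟎` are harmless: each value is overwritten when its vertex is first answered.
untouched-fair : Fair {n} (const 𝟎) [] (untouched n)
untouched-fair .uncaught = ¬Caught-[]
untouched-fair {n} .admissible = All.map⁺ (All.universal (λ _ → (λ ()) ,
  All.map (λ d → distinct⇒≢ _ d , []) (All.all-filter (λ a → T? (distinct a 𝟎)) (reverse (cube n)))) (cube n))
untouched-fair .exhaustive w = inj₂ (_ , ∈-map⁺ _ (∈-cube w))

𝟏 : Bits n
𝟏 = Vec.replicate _ true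

-- Complements have the same XOR as the vertices, so these answers never clash. `𝟎` is left out
-- because the opening has already answered it with its complement `𝟏`.
sourceFacet : Fin n → Commitment n
sourceFacet {n} i =
  map (λ v → v , Vec.map not v) (filterᵇ (λ v → not (Vec.lookup v i) ∧ distinct v 𝟎) (cube n))

opening : ∀ n → Table n
opening n = refine 𝟎 𝟏 (untouched n)

opening-fair : Fair (const 𝟎 [ 𝟎 ↦ 𝟏 ]) (𝟎 ∷ []) (opening (suc n))
opening-fair = answer-fair untouched-fair (∈-map⁺ _ (∈-cube 𝟎))
  (∈-filter⁺ (λ a → T? (distinct a 𝟎)) (reverse⁺ (∈-cube 𝟏)) tt)

starts-at-𝟏 : AgreeOn (𝟎 ∷ []) (const 𝟎 [ 𝟎 ↦ 𝟏 ]) s → s 𝟎 ≡ 𝟏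
starts-at-𝟏 agree = trans (agree (here refl)) ([↦]-updates (const 𝟎) 𝟎 𝟏)

queried-recentred : ∀ u k {s : Outmap n} → s 𝟎 ≡ a →
  queried (translate u (query u k)) s ≡ 𝟎 ∷ queried (translate u (k a)) s
queried-recentred u k {s} s𝟎≡a = cong₂ _∷_ (⊕-self u)
  (cong (λ a → queried (translate u (k a)) s) (trans (cong s (⊕-self u)) s𝟎≡a))

-- Translation by the first query `u` moves it to `𝟎`, so one opening position serves all
-- algorithms. That query takes one unit of `suc r`.
evades⇒unsolved : ∀ commitments r → T (evades commitments r (opening (suc n))) →
  (A : Algorithm (suc n)) → (∀ s → #queries A s ≤ suc r) → ∃[ s ] ¬ Caught s (queried A s)
evades⇒unsolved _ _ _ stop bound = const 𝟎 , ¬Caught-[]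
evades⇒unsolved commitments r ev A@(query u k) bound
  with s , agree , ¬caught ← evades-sound commitments (translate u (k 𝟏)) r ev
         opening-fair (λ s agree → s≤s⁻¹ (subst (_≤ suc r)
           (trans (sym (#queries-translate A s))
                  (cong length (queried-recentred u k (starts-at-𝟏 agree))))
           (bound (s ∘ (_⊕ u)))))
  = s ∘ (_⊕ u) ,
    ¬caught ∘ subst (Caught s) (trans (sym (queried-translate A s))
                                      (queried-recentred u k (starts-at-𝟏 agree)))
            ∘ Caught-translate

-- From the two searches to the value of t.

schedule⇒table : List (Bits n) → Table n
schedule⇒table = map (_, cube _)

wins⇒solves : ∀ r (us : List (Bits n)) → T (wins r (schedule⇒table us)) →
  ∃[ A ] (∀ s → #queries A s ≡ r) × SolvesSinkOrClash {n} A
wins⇒solves r us win with A , count , catches ← wins-sound r (schedule⇒table us) win =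
  A , count , λ s → catches s [] (All.map⁺ (All.universal (λ w → inj₁ (∈-cube (s w))) us))

-- Equations rather than T, since checking tt against T b evaluates b repeatedly.
wins∧evades⇒t : ∀ commitments r us → wins (2 + r) (schedule⇒table us) ≡ true →
  evades commitments r (opening (suc n)) ≡ true → t[ suc n ]≡ (2 + r)
wins∧evades⇒t {n} commitments r us win ev = upper , lower
  where
  upper : ∃[ A ] SolvesSinkOrClash {suc n} A × WorstCase A (2 + r)
  upper with A , count , solves ← wins⇒solves (2 + r) us (from T-≡ win) =
    -- All runs are equally long, so any outmap attains the maximum.
    A , solves , (const 𝟎 , count _) , λ { _ (s , refl) → ≤-reflexive (count s) }

  lower : ∀ k → ∃[ A ] SolvesSinkOrClash {suc n} A × WorstCase A k → 2 + r ≤ k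
  lower k (A , solves , _ , max) = ≮⇒≥ λ k<2+r →
    -- A worst case below `2 + r` allows the opening query and at most `r` more.
    let s , ¬caught = evades⇒unsolved commitments r (from T-≡ ev) A
                        λ s → ≤-trans (max _ (s , refl)) (s≤s⁻¹ k<2+r)
    in ¬caught (solves s)

-- The argument counts the queries left after the current one.
facetCommitments : ℕ → List (Commitment 4)
facetCommitments (suc (suc (suc _))) = map sourceFacet (allFin 4)
facetCommitments _                   = []

pattern O = false
pattern I = true

-- The order in which `wins` tries the vertices: the four fixed ones, then the others of weight two,
-- one and three.
schedule : List (Bits 4)
schedule =
  (O ∷ O ∷ O ∷ O ∷ []) ∷ (I ∷ I ∷ I ∷ I ∷ []) ∷ (O ∷ O ∷ I ∷ I ∷ []) ∷ (I ∷ I ∷ O ∷ O ∷ []) ∷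
  (O ∷ I ∷ O ∷ I ∷ []) ∷ (O ∷ I ∷ I ∷ O ∷ []) ∷ (I ∷ O ∷ O ∷ I ∷ []) ∷ (I ∷ O ∷ I ∷ O ∷ []) ∷
  (O ∷ O ∷ O ∷ I ∷ []) ∷ (O ∷ O ∷ I ∷ O ∷ []) ∷ (O ∷ I ∷ O ∷ O ∷ []) ∷ (I ∷ O ∷ O ∷ O ∷ []) ∷
  (O ∷ I ∷ I ∷ I ∷ []) ∷ (I ∷ O ∷ I ∷ I ∷ []) ∷ (I ∷ I ∷ O ∷ I ∷ []) ∷ (I ∷ I ∷ I ∷ O ∷ []) ∷ []

lemma26 : t[ 4 ]≡ 7
-- With `r = 5`, four queries follow the second and three the third, so `facetCommitments` offers
-- facets at both. The third matters after a second query at `𝟏`, which lies in none of these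
-- facets.
lemma26 = wins∧evades⇒t facetCommitments 5 schedule refl refl
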